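{- Let $K$ be a number field with ring of integers $\mathcal{O}_K$, and let $\alpha \in \mathcal{O}_K$ be non-zero with $n(\alpha) = 2$, where $n(\alpha)$ is the number of principal ideal divisors of $(\alpha)$. Then $\alpha$ is irreducible in $\mathcal{O}_K$.
   Context: For a non-zero $\alpha \in \mathcal{O}_K$ with prime ideal factorization $(\alpha) = \mathfrak{p}_1^{e_1} \cdots \mathfrak{p}_g^{e_g}$ (distinct primes), an ideal divisor of $(\alpha)$ is an ideal of the form $J = \prod_{i=1}^g \mathfrak{p}_i^{f_i}$ with $0 \le f_i \le e_i$; it is a principal ideal divisor if $J = (a)$ for some $a \in \mathcal{O}_K$. The ideals $\mathcal{O}_K = (1)$ and $(\alpha)$ itself count as principal ideal divisors. -}

module Defs where

open import Algebra.Apartness.Bundles using (HeytingField; HeytingCommutativeRing)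
open import Algebra.Bundles using (CommutativeRing; RawMonoid; RawRing)
import Algebra.Definitions.RawMonoid as RawMonoidDefs
import Algebra.Definitions.RawSemiring as RawSemiringDefs
open import Algebra.Morphism.Structures using (IsRingHomomorphism; IsRingMonomorphism)
import Algebra.Morphism.RingMonomorphism as RingMonomorphism
import Algebra.Properties.Ring as RingProperties
import Algebra.Properties.Semiring.Exp as Exp
import Algebra.Properties.Semiring.Sum as Sum
import Algebra.Solver.Ring.NaturalCoefficients.Default as SemiringSolver
open import Data.Fin.Base using (Fin; toℕ)
import Data.Fin.Base as Fin
open import Data.Integer.Base as ℤ using (ℤ; +_; -[1+_])
import Data.Integer.Properties as ℤ
open import Data.List.Base using (List; []; _∷_; map)
open import Data.List.Membership.Propositional using (_∈_)
open import Data.List.Membership.Propositional.Properties using (∈-map⁻)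
open import Data.List.Relation.Unary.Any using (here; there)
open import Data.Nat.Base as ℕ using (ℕ; zero; suc)
import Data.Nat.Properties as ℕ
open import Data.Product.Base using (Σ-syntax; ∃; ∃-syntax; _×_; _,_; proj₁; proj₂)
open import Data.Rational.Base as ℚ using (ℚ; 0ℚ; _/_)
import Data.Rational.Properties as ℚ
import Data.Rational.Unnormalised.Base as ℚᵘ
import Data.Rational.Unnormalised.Properties as ℚᵘ
open import Data.Sum.Base using (_⊎_)
open import Data.Vec.Functional using (Vector)
open import Function.Bundles using (Inverse)
open import Function.Definitions using (Injective)
open import Level using (Level; _⊔_) renaming (suc to lsuc)
open import Relation.Binary.Bundles using (Setoid)
open import Relation.Binary.Definitions using (_Respects_)
open import Relation.Binary.PropositionalEquality as ≡ using (_≡_)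
import Relation.Binary.Reasoning.Setoid as SetoidReasoning
open import Relation.Nullary.Negation using (¬_)
open import Relation.Unary using (Pred; _≐_)

private variable
  c ℓ ℓ₁ ℓ₂ s : Level

-- The library's fields carry an apartness relation; `≉⇒#` says that it is
-- the denial of equality, so that every non-zero element is invertible.

record NumberField c ℓ₁ ℓ₂ : Set (lsuc (c ⊔ ℓ₁ ⊔ ℓ₂)) where
  field
    heytingField : HeytingField c ℓ₁ ℓ₂

  open HeytingField heytingField public

  commutativeRing : CommutativeRing c ℓ₁
  commutativeRing = HeytingCommutativeRing.commutativeRing heytingCommutativeRing

  open CommutativeRing commutativeRing public using (rawRing; semiring)
  open RawSemiringDefs (RawRing.rawSemiring rawRing) public
    using (sum; _^_)

  field
    ≉⇒#         : ∀ {x y} → ¬ (x ≈ y) → x # y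
    ι           : ℚ → Carrier
    ι-homo      : IsRingHomomorphism ℚ.+-*-rawRing rawRing ι
    degree      : ℕ
    basis       : Vector Carrier degree
    spanning    : ∀ x → Σ[ q ∈ Vector ℚ degree ]
                  x ≈ sum (λ i → ι (q i) * basis i)
    independent : ∀ (q : Vector ℚ degree) →
                  sum (λ i → ι (q i) * basis i) ≈ 0# → ∀ i → q i ≡ 0ℚ

  ιℤ : ℤ → Carrier
  ιℤ k = ι (k / 1)

  Integral : Pred Carrier ℓ₁
  Integral x = ∃[ n ] Σ[ a ∈ Vector ℤ n ]
    x ^ n + sum (λ i → ιℤ (a i) * x ^ toℕ i) ≈ 0#

-- The elements of R integral over a subring S form a subring; this is what
-- makes the ring of integers below a ring.
module IntegralClosure (R : CommutativeRing c ℓ) where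

  open CommutativeRing R
  open RingProperties ring using (-1*x≈-x; -‿distribˡ-*; -‿distribʳ-*)
  open Exp semiring using (_^_; ^-homo-*)
  open SetoidReasoning setoid
  open SemiringSolver commutativeSemiring using (solve; _:+_; _:*_; _:=_)

  record IsSubring (S : Pred Carrier s) : Set (c ⊔ ℓ ⊔ s) where
    field
      resp : S Respects _≈_
      0∈   : S 0#
      1∈   : S 1#
      +∈   : ∀ {a b} → S a → S b → S (a + b)
      *∈   : ∀ {a b} → S a → S b → S (a * b)
      -1∈  : S (- 1#)

  ring1 : ∀ a b z a′ b′ → (a + z * a′) + (b + z * b′) ≈ (a + b) + z * (a′ + b′)
  ring1 = solve 5 (λ a b z a′ b′ → (a :+ z :* a′) :+ (b :+ z :* b′) := (a :+ b) :+ z :* (a′ :+ b′)) refl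

  ring2 : ∀ t a z a′ → t * (a + z * a′) ≈ t * a + z * (t * a′)
  ring2 = solve 4 (λ t a z a′ → t :* (a :+ z :* a′) := t :* a :+ z :* (t :* a′)) refl

  ring3 : ∀ a z a′ b → a * b + z * (a′ * b) ≈ (a + z * a′) * b
  ring3 = solve 4 (λ a z a′ b → a :* b :+ z :* (a′ :* b) := (a :+ z :* a′) :* b) refl

  ring4 : ∀ a z b t w → a + z * (b + t * w) ≈ (a + z * b) + t * (z * w)
  ring4 = solve 5 (λ a z b t w → a :+ z :* (b :+ t :* w) := (a :+ z :* b) :+ t :* (z :* w)) refl

  ring5 : ∀ u a v b → (u + a) * (v + b) ≈ u * v + ((u * b + a * v) + a * b)
  ring5 = solve 4 (λ u a v b → (u :+ a) :* (v :+ b) := u :* v :+ ((u :* b :+ a :* v) :+ a :* b)) refl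

  ring6 : ∀ l v x k y → (l * v + x) + (k * v + y) ≈ (l + k) * v + (x + y)
  ring6 = solve 5 (λ l v x k y → (l :* v :+ x) :+ (k :* v :+ y) := (l :+ k) :* v :+ (x :+ y)) refl

  ring7 : ∀ a l v y → a * (l * v + y) ≈ (a * l) * v + a * y
  ring7 = solve 4 (λ a l v y → a :* (l :* v :+ y) := (a :* l) :* v :+ a :* y) refl

  ring8 : ∀ x l v y → x * (l * v + y) ≈ l * (x * v) + x * y
  ring8 = solve 4 (λ x l v y → x :* (l :* v :+ y) := l :* (x :* v) :+ x :* y) refl

  ring9 : ∀ m l v y → m * (l * v + y) ≈ l * (m * v) + m * y
  ring9 = solve 4 (λ m l v y → m :* (l :* v :+ y) := l :* (m :* v) :+ m :* y) refl

  ring10 : ∀ x x′ y → (x + x′) + y ≈ (x + y) + x′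
  ring10 = solve 3 (λ x x′ y → (x :+ x′) :+ y := (x :+ y) :+ x′) refl

  ring11 : ∀ w l v y → w * (l * v + y) ≈ l * (w * v) + w * y
  ring11 = solve 4 (λ w l v y → w :* (l :* v :+ y) := l :* (w :* v) :+ w :* y) refl

  ring12 : ∀ l l₀ v y₀ y → l * (l₀ * v + y₀) + y ≈ l₀ * (l * v) + (l * y₀ + y)
  ring12 = solve 5 (λ l l₀ v y₀ y → l :* (l₀ :* v :+ y₀) :+ y := l₀ :* (l :* v) :+ (l :* y₀ :+ y)) refl

  ring13 : ∀ x y u v → (x * y) * (u * v) ≈ (y * u) * (x * v)
  ring13 = solve 4 (λ x y u v → (x :* y) :* (u :* v) := (y :* u) :* (x :* v)) refl

  ring14 : ∀ y w a x a′ → (y * w) * (a + x * a′) ≈ (y * w) * a + (x * y) * (w * a′)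
  ring14 = solve 5 (λ y w a x a′ → (y :* w) :* (a :+ x :* a′) := (y :* w) :* a :+ (x :* y) :* (w :* a′)) refl

  -- Low n y : y = s₀ + s₁ z + ⋯ + sₙ₋₁ zⁿ⁻¹ with all sᵢ in S.
  module Polys {S : Pred Carrier s} (isSubring : IsSubring S) (z : Carrier) where

    open IsSubring isSubring

    Low : ℕ → Pred Carrier (c ⊔ ℓ ⊔ s)
    Low zero    y = Level.Lift (c ⊔ s) (y ≈ 0#)
    Low (suc n) y = ∃[ a ] ∃[ y′ ] S a × Low n y′ × y ≈ a + z * y′

    Mon : ℕ → Pred Carrier (c ⊔ ℓ ⊔ s)
    Mon n y = ∃[ a ] Low n a × y ≈ z ^ n + a

    low-resp : ∀ n → Low n Respects _≈_
    low-resp zero    p (Level.lift q) = Level.lift (trans (sym p) q)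
    low-resp (suc n) p (a , y′ , Sa , l , q) = a , y′ , Sa , l , trans (sym p) q

    low-0 : ∀ n → Low n 0#
    low-0 zero    = Level.lift refl
    low-0 (suc n) = 0# , 0# , 0∈ , low-0 n ,
      sym (trans (+-congˡ (zeroʳ z)) (+-identityʳ 0#))

    low-+ : ∀ n {a b} → Low n a → Low n b → Low n (a + b)
    low-+ zero (Level.lift p) (Level.lift q) =
      Level.lift (trans (+-cong p q) (+-identityʳ 0#))
    low-+ (suc n) (a , a′ , Sa , la , p) (b , b′ , Sb , lb , q) =
      a + b , a′ + b′ , +∈ Sa Sb , low-+ n la lb ,
      trans (+-cong p q) (ring1 a b z a′ b′)

    low-scale : ∀ n {t a} → S t → Low n a → Low n (t * a)
    low-scale zero    St (Level.lift p) = Level.lift (trans (*-congˡ p) (zeroʳ _))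
    low-scale (suc n) {t} St (a , a′ , Sa , la , p) =
      t * a , t * a′ , *∈ St Sa , low-scale n St la ,
      trans (*-congˡ p) (ring2 t a z a′)

    low-neg : ∀ n {a} → Low n a → Low n (- a)
    low-neg n la = low-resp n (-1*x≈-x _) (low-scale n -1∈ la)

    low-const : ∀ n {a} → S a → Low (suc n) a
    low-const n {a} Sa = a , 0# , Sa , low-0 n ,
      sym (trans (+-congˡ (zeroʳ z)) (+-identityʳ a))

    low-shift : ∀ n {a} → Low n a → Low (suc n) (z * a)
    low-shift n {a} la = 0# , a , 0∈ , la , sym (+-identityˡ _)

    low-weaken : ∀ n {a} → Low n a → Low (suc n) a
    low-weaken zero    (Level.lift p) = low-resp 1 (sym p) (low-0 1)
    low-weaken (suc n) (a , a′ , Sa , la , p) = a , a′ , Sa , low-weaken n la , p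

    low-weakenˡ : ∀ m n {a} → Low n a → Low (m ℕ.+ n) a
    low-weakenˡ zero    n la = la
    low-weakenˡ (suc m) n la = low-weaken (m ℕ.+ n) (low-weakenˡ m n la)

    low-weakenʳ : ∀ m n {a} → Low n a → Low (n ℕ.+ m) a
    low-weakenʳ m n {a} la = ≡.subst (λ k → Low k a) (ℕ.+-comm m n) (low-weakenˡ m n la)

    low-* : ∀ m n {a b} → Low m a → Low n b → Low (m ℕ.+ n) (a * b)
    low-* zero n (Level.lift p) lb =
      low-resp n (sym (trans (*-congʳ p) (zeroˡ _))) (low-0 n)
    low-* (suc m) n {b = b} (a , a′ , Sa , la , p) lb =
      low-resp (suc m ℕ.+ n) (trans (ring3 a z a′ b) (*-congʳ (sym p)))
        (low-+ (suc m ℕ.+ n)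
          (low-weakenˡ (suc m) n (low-scale n Sa lb))
          (low-shift (m ℕ.+ n) (low-* m n la lb)))

    low-^* : ∀ m n {a} → Low n a → Low (m ℕ.+ n) (z ^ m * a)
    low-^* zero    n la = low-resp n (sym (*-identityˡ _)) la
    low-^* (suc m) n la =
      low-resp (suc m ℕ.+ n) (sym (*-assoc z (z ^ m) _)) (low-shift (m ℕ.+ n) (low-^* m n la))

    low-*^ : ∀ m n {a} → Low m a → Low (m ℕ.+ n) (a * z ^ n)
    low-*^ m n {a} la = ≡.subst (λ k → Low k (a * z ^ n)) (ℕ.+-comm n m)
      (low-resp (n ℕ.+ m) (*-comm (z ^ n) a) (low-^* n m la))

    low-^ : ∀ n → Low (suc n) (z ^ n)
    low-^ zero    = low-const 0 1∈
    low-^ (suc n) = low-shift (suc n) (low-^ n)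

    low-top : ∀ n {a} → Low (suc n) a → ∃[ b ] ∃[ t ] Low n b × S t × a ≈ b + t * z ^ n
    low-top zero (a , a′ , Sa , Level.lift q , p) = 0# , a , Level.lift refl , Sa , (begin
      _             ≈⟨ p ⟩
      a + z * a′    ≈⟨ +-congˡ (trans (*-congˡ q) (zeroʳ z)) ⟩
      a + 0#        ≈⟨ +-comm a 0# ⟩
      0# + a        ≈⟨ +-congˡ (*-identityʳ a) ⟨
      0# + a * 1#   ∎)
    low-top (suc n) (a , a′ , Sa , la , p) with low-top n la
    ... | b , t , lb , St , q =
      a + z * b , t , (a , b , Sa , lb , refl) , St ,
      trans p (trans (+-congˡ (*-congˡ q)) (ring4 a z b t (z ^ n)))

    mon-resp : ∀ n → Mon n Respects _≈_
    mon-resp n p (a , la , q) = a , la , trans (sym p) q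

    mon-* : ∀ m n {a b} → Mon m a → Mon n b → Mon (m ℕ.+ n) (a * b)
    mon-* m n {x} {y} (a , la , p) (b , lb , q) =
      (z ^ m * b + a * z ^ n) + a * b ,
      low-+ (m ℕ.+ n) (low-+ (m ℕ.+ n) (low-^* m n lb) (low-*^ m n la)) (low-* m n la lb) ,
      (begin
        x * y                                                 ≈⟨ *-cong p q ⟩
        (z ^ m + a) * (z ^ n + b)                             ≈⟨ ring5 (z ^ m) a (z ^ n) b ⟩
        z ^ m * z ^ n + ((z ^ m * b + a * z ^ n) + a * b)     ≈⟨ +-congʳ (^-homo-* z m n) ⟨
        z ^ (m ℕ.+ n) + ((z ^ m * b + a * z ^ n) + a * b)     ∎)

    mon-+low : ∀ n {a b} → Mon n a → Low n b → Mon n (a + b)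
    mon-+low n {b = b} (a , la , p) lb =
      a + b , low-+ n la lb , trans (+-congʳ p) (+-assoc _ a b)

    -- Comb n vs y : y is a combination of vs with coefficients in Low n.
    Comb : ℕ → List Carrier → Pred Carrier (c ⊔ ℓ ⊔ s)
    Comb n []       y = Level.Lift (c ⊔ s) (y ≈ 0#)
    Comb n (v ∷ vs) y = ∃[ l ] ∃[ y′ ] Low n l × Comb n vs y′ × y ≈ l * v + y′

    comb-resp : ∀ n vs → Comb n vs Respects _≈_
    comb-resp n []       p (Level.lift q) = Level.lift (trans (sym p) q)
    comb-resp n (v ∷ vs) p (l , y′ , ll , cy , q) = l , y′ , ll , cy , trans (sym p) q

    comb-0 : ∀ n vs → Comb n vs 0#
    comb-0 n []       = Level.lift refl
    comb-0 n (v ∷ vs) = 0# , 0# , low-0 n , comb-0 n vs ,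
      sym (trans (+-congʳ (zeroˡ v)) (+-identityʳ 0#))

    comb-+ : ∀ n vs {x y} → Comb n vs x → Comb n vs y → Comb n vs (x + y)
    comb-+ n [] (Level.lift p) (Level.lift q) =
      Level.lift (trans (+-cong p q) (+-identityʳ 0#))
    comb-+ n (v ∷ vs) (l , x′ , ll , cx , p) (k , y′ , lk , cy , q) =
      l + k , x′ + y′ , low-+ n ll lk , comb-+ n vs cx cy ,
      trans (+-cong p q) (ring6 l v x′ k y′)

    comb-scale : ∀ m n vs {a y} → (∀ {l} → Low m l → Low n (a * l)) →
                 Comb m vs y → Comb n vs (a * y)
    comb-scale m n []       f (Level.lift p) = Level.lift (trans (*-congˡ p) (zeroʳ _))
    comb-scale m n (v ∷ vs) {a} f (l , y′ , ll , cy , p) =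
      a * l , a * y′ , f ll , comb-scale m n vs f cy ,
      trans (*-congˡ p) (ring7 a l v y′)

    comb-∈ : ∀ n {vs v l} → v ∈ vs → Low n l → Comb n vs (l * v)
    comb-∈ n {v ∷ vs} (here ≡.refl) ll = _ , 0# , ll , comb-0 n vs , sym (+-identityʳ _)
    comb-∈ n {w ∷ vs} (there v∈)    ll =
      0# , _ , low-0 n , comb-∈ n v∈ ll ,
      sym (trans (+-congʳ (zeroˡ w)) (+-identityˡ _))

    comb-map : ∀ n vs {x y} → Comb n vs y → Comb n (map (x *_) vs) (x * y)
    comb-map n []       (Level.lift p) = Level.lift (trans (*-congˡ p) (zeroʳ _))
    comb-map n (v ∷ vs) {x} (l , y′ , ll , cy , p) =
      l , x * y′ , ll , comb-map n vs cy , trans (*-congˡ p) (ring8 x l v y′)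

    comb-kill : ∀ n vs {m y} → (∀ {v} → v ∈ vs → m * v ≈ 0#) → Comb n vs y → m * y ≈ 0#
    comb-kill n []       f (Level.lift p) = trans (*-congˡ p) (zeroʳ _)
    comb-kill n (v ∷ vs) {m} {y} f (l , y′ , ll , cy , p) = begin
      m * y                  ≈⟨ *-congˡ p ⟩
      m * (l * v + y′)       ≈⟨ ring9 m l v y′ ⟩
      l * (m * v) + m * y′   ≈⟨ +-cong (*-congˡ (f (here ≡.refl)))
                                       (comb-kill n vs (λ v∈ → f (there v∈)) cy) ⟩
      l * 0# + 0#            ≈⟨ trans (+-identityʳ _) (zeroʳ l) ⟩
      0#                     ∎

    x+y≈w⇒y≈w-x : ∀ {x y w} → w ≈ x + y → y ≈ w + (- x)
    x+y≈w⇒y≈w-x {x} {y} {w} p = begin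
      y                ≈⟨ +-identityˡ y ⟨
      0# + y           ≈⟨ +-congʳ (-‿inverseʳ x) ⟨
      (x + (- x)) + y  ≈⟨ ring10 x (- x) y ⟩
      (x + y) + (- x)  ≈⟨ +-congʳ p ⟨
      w + (- x)        ∎

    -- Fraction-free Gaussian elimination of the system (zⁿ - L) vs = 0; the
    -- diagonal stays monic of degree exceeding that of all other entries.
    eliminate : ∀ n vs → (∀ {v} → v ∈ vs → Comb n vs (z ^ n * v)) →
                ∃[ p ] ∃[ m ] Mon p m × (∀ {v} → v ∈ vs → m * v ≈ 0#)
    eliminate n [] f = 0 , 1# , (0# , Level.lift refl , sym (+-identityʳ 1#)) , λ ()
    eliminate n (v₀ ∷ vs) f = p ℕ.+ n , m * m₀ ,
      mon-* p n mm (- l₀ , low-neg n ll₀ , refl) , kill′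
      where
      w = z ^ n
      row₀ = f (here ≡.refl)
      l₀   = proj₁ row₀
      y₀   = proj₁ (proj₂ row₀)
      ll₀  = proj₁ (proj₂ (proj₂ row₀))
      cy₀  = proj₁ (proj₂ (proj₂ (proj₂ row₀)))

      eq₀ : w * v₀ ≈ l₀ * v₀ + y₀
      eq₀  = proj₂ (proj₂ (proj₂ (proj₂ row₀)))

      rows : ∀ {v} → v ∈ vs → Comb (n ℕ.+ n) vs (z ^ (n ℕ.+ n) * v)
      rows {v} v∈ with f (there v∈)
      ... | l , y , ll , cy , eq =
        comb-resp (n ℕ.+ n) vs (sym row)
          (comb-+ (n ℕ.+ n) vs
            (comb-+ (n ℕ.+ n) vs
              (comb-∈ (n ℕ.+ n) v∈ (low-*^ n n ll₀))
              (comb-scale n (n ℕ.+ n) vs (low-* n n (low-neg n ll₀)) cy))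
            (comb-+ (n ℕ.+ n) vs
              (comb-scale n (n ℕ.+ n) vs (low-* n n ll) cy₀)
              (comb-scale n (n ℕ.+ n) vs (low-^* n n) cy)))
        where
        l*v₀ : l * v₀ ≈ w * v + (- y)
        l*v₀ = x+y≈w⇒y≈w-x (trans eq (+-comm _ _))
        neg-swap : l₀ * (- y) ≈ (- l₀) * y
        neg-swap = trans (sym (-‿distribʳ-* l₀ y)) (-‿distribˡ-* l₀ y)
        row : z ^ (n ℕ.+ n) * v ≈ ((l₀ * w) * v + (- l₀) * y) + (l * y₀ + w * y)
        row = begin
          z ^ (n ℕ.+ n) * v                                ≈⟨ *-congʳ (^-homo-* z n n) ⟩
          (w * w) * v                                      ≈⟨ *-assoc w w v ⟩
          w * (w * v)                                      ≈⟨ *-congˡ eq ⟩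
          w * (l * v₀ + y)                                 ≈⟨ ring11 w l v₀ y ⟩
          l * (w * v₀) + w * y                             ≈⟨ +-congʳ (*-congˡ eq₀) ⟩
          l * (l₀ * v₀ + y₀) + w * y                       ≈⟨ ring12 l l₀ v₀ y₀ (w * y) ⟩
          l₀ * (l * v₀) + (l * y₀ + w * y)                 ≈⟨ +-congʳ (*-congˡ l*v₀) ⟩
          l₀ * (w * v + (- y)) + (l * y₀ + w * y)          ≈⟨ +-congʳ (distribˡ l₀ (w * v) (- y)) ⟩
          (l₀ * (w * v) + l₀ * (- y)) + (l * y₀ + w * y)   ≈⟨ +-congʳ (+-cong (sym (*-assoc l₀ w v)) neg-swap) ⟩
          ((l₀ * w) * v + (- l₀) * y) + (l * y₀ + w * y)   ∎

      rest = eliminate (n ℕ.+ n) vs rows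
      p    = proj₁ rest
      m    = proj₁ (proj₂ rest)
      mm   = proj₁ (proj₂ (proj₂ rest))

      kill : ∀ {v} → v ∈ vs → m * v ≈ 0#
      kill = proj₂ (proj₂ (proj₂ rest))

      m₀ = w + (- l₀)

      m₀v₀ : m₀ * v₀ ≈ y₀
      m₀v₀ = begin
        (w + (- l₀)) * v₀         ≈⟨ distribʳ v₀ w (- l₀) ⟩
        w * v₀ + (- l₀) * v₀      ≈⟨ +-congˡ (-‿distribˡ-* l₀ v₀) ⟨
        w * v₀ + (- (l₀ * v₀))    ≈⟨ x+y≈w⇒y≈w-x eq₀ ⟨
        y₀                        ∎

      kill′ : ∀ {v} → v ∈ v₀ ∷ vs → (m * m₀) * v ≈ 0#
      kill′ (here ≡.refl) = begin
        (m * m₀) * v₀   ≈⟨ *-assoc m m₀ v₀ ⟩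
        m * (m₀ * v₀)   ≈⟨ *-congˡ m₀v₀ ⟩
        m * y₀          ≈⟨ comb-kill n vs kill cy₀ ⟩
        0#              ∎
      kill′ {v} (there v∈) = begin
        (m * m₀) * v    ≈⟨ *-congʳ (*-comm m m₀) ⟩
        (m₀ * m) * v    ≈⟨ *-assoc m₀ m v ⟩
        m₀ * (m * v)    ≈⟨ *-congˡ (kill v∈) ⟩
        m₀ * 0#         ≈⟨ zeroʳ m₀ ⟩
        0#              ∎

  module _ {S : Pred Carrier s} (isSubring : IsSubring S) where

    open IsSubring isSubring
    open Polys

    IntegralOver : Pred Carrier (c ⊔ ℓ ⊔ s)
    IntegralOver z = ∃[ n ] Mon isSubring z n 0#

    module Adjoin (y : Carrier) where

      S[y] : Pred Carrier (c ⊔ ℓ ⊔ s)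
      S[y] a = ∃[ k ] Low isSubring y k a

      S⊆S[y] : ∀ {a} → S a → S[y] a
      S⊆S[y] Sa = 1 , low-const isSubring y 0 Sa

      isSubring[y] : IsSubring S[y]
      isSubring[y] = record
        { resp = λ { p (k , la) → k , low-resp isSubring y k p la }
        ; 0∈   = 0 , Level.lift refl
        ; 1∈   = S⊆S[y] 1∈
        ; +∈   = λ { (k , la) (j , lb) → k ℕ.+ j ,
                     low-+ isSubring y (k ℕ.+ j) (low-weakenʳ isSubring y j k la)
                                                (low-weakenˡ isSubring y k j lb) }
        ; *∈   = λ { (k , la) (j , lb) → k ℕ.+ j , low-* isSubring y k j la lb }
        ; -1∈  = S⊆S[y] -1∈
        }

      y∈ : S[y] y
      y∈ = 2 , low-resp isSubring y 2 (*-identityʳ y) (low-^ isSubring y 1)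

      ^∈ : ∀ n → S[y] (y ^ n)
      ^∈ n = suc n , low-^ isSubring y n

      powers : ℕ → List Carrier
      powers zero    = []
      powers (suc k) = 1# ∷ map (y *_) (powers k)

      powers∈ : ∀ k {v} → v ∈ powers k → S[y] v
      powers∈ (suc k) (here ≡.refl) = IsSubring.1∈ isSubring[y]
      powers∈ (suc k) (there v∈) with ∈-map⁻ (y *_) v∈
      ... | w , w∈ , ≡.refl = IsSubring.*∈ isSubring[y] y∈ (powers∈ k w∈)

      reduce : ∀ k → Mon isSubring y k 0# → ∀ {a} → S[y] a → Low isSubring y k a
      reduce k (r , lr , eq) (j , la) = go j la
        where
        LowK = Low isSubring y k

        y^k : LowK (y ^ k)
        y^k = low-resp isSubring y k (trans (sym (+-identityˡ _)) (sym (x+y≈w⇒y≈w-x isSubring y (trans eq (+-comm _ _)))))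
                (low-neg isSubring y k lr)

        1∈K : ∀ k → Low isSubring y k (y ^ k) → Low isSubring y k 1#
        1∈K zero    l = l
        1∈K (suc k) l = low-const isSubring y k 1∈

        const : ∀ {a} → S a → LowK a
        const Sa = low-resp isSubring y k (*-identityʳ _)
          (low-scale isSubring y k Sa (1∈K k y^k))

        shift : ∀ {a} → LowK a → LowK (y * a)
        shift la with low-top isSubring y k (low-shift isSubring y k la)
        ... | b , t , lb , St , p =
          low-resp isSubring y k (sym p)
            (low-+ isSubring y k lb (low-scale isSubring y k St y^k))

        go : ∀ j {a} → Low isSubring y j a → LowK a
        go zero    (Level.lift p) = low-resp isSubring y k (sym p) (low-0 isSubring y k)
        go (suc j) (a , a′ , Sa , la , p) =
          low-resp isSubring y k (sym p) (low-+ isSubring y k (const Sa) (shift (go j la)))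

      spread : ∀ z n k {t} → Low isSubring y k t → Comb isSubring z (suc n) (powers k) t
      spread z n zero    (Level.lift p) = Level.lift p
      spread z n (suc k) (a , a′ , Sa , la , p) =
        a , y * a′ , low-const isSubring z n Sa ,
        comb-map isSubring z (suc n) (powers k) (spread z n k la) ,
        trans p (+-congʳ (sym (*-identityʳ a)))

      flatten : ∀ z k → Mon isSubring y k 0# → ∀ n {a} →
                Low isSubring[y] z n a → Comb isSubring z n (powers k) a
      flatten z k int zero (Level.lift p) =
        comb-resp isSubring z 0 (powers k) (sym p) (comb-0 isSubring z 0 (powers k))
      flatten z k int (suc n) (t , a′ , Tt , la , p) =
        comb-resp isSubring z (suc n) (powers k) (sym p)
          (comb-+ isSubring z (suc n) (powers k)
            (spread z n k (reduce k int Tt))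
            (comb-scale isSubring z n (suc n) (powers k) (low-shift isSubring z n)
              (flatten z k int n la)))

      tower : ∀ z → IntegralOver y → ∀ n → Mon isSubring[y] z n 0# → IntegralOver z
      tower z (zero , r , Level.lift r≈0 , eq) n _ = 0 , 0# , Level.lift refl ,
        trans eq (+-congˡ r≈0)
      tower z (k@(suc _) , int) n (a , la , eq) =
        p , mon-resp isSubring z p (trans (sym (*-identityʳ m)) (kill (here ≡.refl))) mm
        where
        z^n : z ^ n ≈ - a
        z^n = trans (x+y≈w⇒y≈w-x isSubring y (trans eq (+-comm _ _))) (+-identityˡ _)

        elim : ∃[ p ] ∃[ m ] Mon isSubring z p m × (∀ {v} → v ∈ powers k → m * v ≈ 0#)
        elim = eliminate isSubring z n (powers k) (λ {v} v∈ →
          flatten z k int n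
            (low-resp isSubring[y] z n
              (trans (*-comm v (- a)) (*-congʳ (sym z^n)))
              (low-scale isSubring[y] z n (powers∈ k v∈) (low-neg isSubring[y] z n la))))

        p    = proj₁ elim
        m    = proj₁ (proj₂ elim)
        mm   = proj₁ (proj₂ (proj₂ elim))
        kill : ∀ {v} → v ∈ powers k → m * v ≈ 0#
        kill = proj₂ (proj₂ (proj₂ elim))

    integral-resp : IntegralOver Respects _≈_
    integral-resp {x} {y} p (n , int) = n , mon n int
      where
      low : ∀ n {a} → Low isSubring x n a → Low isSubring y n a
      low zero    (Level.lift q) = Level.lift q
      low (suc n) (a , a′ , Sa , la , q) = a , a′ , Sa , low n la , trans q (+-congˡ (*-congʳ p))

      ^-resp : ∀ n → x ^ n ≈ y ^ n
      ^-resp zero    = refl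
      ^-resp (suc n) = *-cong p (^-resp n)

      mon : ∀ n {a} → Mon isSubring x n a → Mon isSubring y n a
      mon n (a , la , q) = a , low n la , trans q (+-congʳ (^-resp n))

    integral-const : ∀ {x} → S x → IntegralOver x
    integral-const {x} Sx = 1 , - x ,
      low-neg isSubring x 1 (low-const isSubring x 0 Sx) ,
      sym (trans (+-congʳ (*-identityʳ x)) (-‿inverseʳ x))

    integral-+ : ∀ {x y} → IntegralOver x → IntegralOver y → IntegralOver (x + y)
    integral-+ {x} {y} (n , a , la , eq) inty =
      tower z inty n
        (mon-resp isSubring[y] z n (sym eq) (mon-+low isSubring[y] z n (pow n) (low n la)))
      where
      open Adjoin y
      z = x + y
      module T = IsSubring isSubring[y]

      x≈z-y : x ≈ z + (- y)
      x≈z-y = x+y≈w⇒y≈w-x isSubring y (+-comm x y)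

      low : ∀ n {a} → Low isSubring x n a → Low isSubring[y] z n a
      low zero    (Level.lift p) = Level.lift p
      low (suc n) (a , a′ , Sa , la , p) =
        low-resp isSubring[y] z (suc n)
          (sym (trans p (+-congˡ (trans (*-congʳ x≈z-y) (distribʳ a′ z (- y))))))
          (low-+ isSubring[y] z (suc n) (low-const isSubring[y] z n (S⊆S[y] Sa))
            (low-+ isSubring[y] z (suc n)
              (low-shift isSubring[y] z n (low n la))
              (low-weaken isSubring[y] z n
                (low-scale isSubring[y] z n -y∈ (low n la)))))
        where
        -y∈ : S[y] (- y)
        -y∈ = T.resp (-1*x≈-x y) (T.*∈ T.-1∈ y∈)

      x∈Mon : Mon isSubring[y] z 1 x
      x∈Mon = - y , low-const isSubring[y] z 0 (T.resp (-1*x≈-x y) (T.*∈ T.-1∈ y∈)) ,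
        trans x≈z-y (+-congʳ (sym (*-identityʳ z)))

      pow : ∀ n → Mon isSubring[y] z n (x ^ n)
      pow zero    = 0# , Level.lift refl , sym (+-identityʳ 1#)
      pow (suc n) = mon-* isSubring[y] z 1 n x∈Mon (pow n)

    integral-* : ∀ {x y} → IntegralOver x → IntegralOver y → IntegralOver (x * y)
    integral-* {x} {y} (n , a , la , eq) inty =
      tower z inty n (y ^ n * a , low n la , sym (begin
        z ^ n + y ^ n * a           ≈⟨ +-congʳ (pow n) ⟩
        y ^ n * x ^ n + y ^ n * a   ≈⟨ distribˡ (y ^ n) (x ^ n) a ⟨
        y ^ n * (x ^ n + a)         ≈⟨ *-congˡ eq ⟨
        y ^ n * 0#                  ≈⟨ zeroʳ (y ^ n) ⟩
        0#                          ∎))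
      where
      open Adjoin y
      z = x * y
      module T = IsSubring isSubring[y]

      pow : ∀ n → z ^ n ≈ y ^ n * x ^ n
      pow zero    = sym (*-identityˡ 1#)
      pow (suc n) = trans (*-congˡ (pow n)) (ring13 x y (y ^ n) (x ^ n))

      low : ∀ n {a} → Low isSubring x n a → Low isSubring[y] z n (y ^ n * a)
      low zero    (Level.lift p) = Level.lift (trans (*-congˡ p) (zeroʳ _))
      low (suc n) (a , a′ , Sa , la , p) =
        y ^ suc n * a , y ^ n * a′ , T.*∈ (^∈ (suc n)) (S⊆S[y] Sa) , low n la ,
        trans (*-congˡ p) (ring14 y (y ^ n) a x a′)

    isSubring-closure : IsSubring IntegralOver
    isSubring-closure = record
      { resp = integral-resp
      ; 0∈   = integral-const 0∈
      ; 1∈   = integral-const 1∈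
      ; +∈   = integral-+
      ; *∈   = integral-*
      ; -1∈  = integral-const -1∈
      }

fromℤ-+ : ∀ a b → (a ℤ.+ b) / 1 ≡ a / 1 ℚ.+ b / 1
fromℤ-+ a b = ℚ.toℚᵘ-injective (begin
  ℚ.toℚᵘ ((a ℤ.+ b) / 1)                  ≈⟨ ℚ.toℚᵘ-fromℚᵘ (ℚᵘ.mkℚᵘ (a ℤ.+ b) 0) ⟩
  ℚᵘ.mkℚᵘ (a ℤ.+ b) 0                     ≈⟨ ℚᵘ.*≡* (≡.cong (ℤ._* ℤ.1ℤ)
                                               (≡.sym (≡.cong₂ ℤ._+_ (ℤ.*-identityʳ a) (ℤ.*-identityʳ b)))) ⟩
  ℚᵘ.mkℚᵘ a 0 ℚᵘ.+ ℚᵘ.mkℚᵘ b 0            ≈⟨ ℚᵘ.+-cong (ℚ.toℚᵘ-fromℚᵘ (ℚᵘ.mkℚᵘ a 0))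
                                                       (ℚ.toℚᵘ-fromℚᵘ (ℚᵘ.mkℚᵘ b 0)) ⟨
  ℚ.toℚᵘ (a / 1) ℚᵘ.+ ℚ.toℚᵘ (b / 1)      ≈⟨ ℚ.toℚᵘ-homo-+ (a / 1) (b / 1) ⟨
  ℚ.toℚᵘ (a / 1 ℚ.+ b / 1)                ∎)
  where open SetoidReasoning ℚᵘ.≃-setoid

fromℤ-* : ∀ a b → (a ℤ.* b) / 1 ≡ (a / 1) ℚ.* (b / 1)
fromℤ-* a b = ℚ.toℚᵘ-injective (begin
  ℚ.toℚᵘ ((a ℤ.* b) / 1)                  ≈⟨ ℚ.toℚᵘ-fromℚᵘ (ℚᵘ.mkℚᵘ (a ℤ.* b) 0) ⟩
  ℚᵘ.mkℚᵘ a 0 ℚᵘ.* ℚᵘ.mkℚᵘ b 0            ≈⟨ ℚᵘ.*-cong (ℚ.toℚᵘ-fromℚᵘ (ℚᵘ.mkℚᵘ a 0))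
                                                       (ℚ.toℚᵘ-fromℚᵘ (ℚᵘ.mkℚᵘ b 0)) ⟨
  ℚ.toℚᵘ (a / 1) ℚᵘ.* ℚ.toℚᵘ (b / 1)      ≈⟨ ℚ.toℚᵘ-homo-* (a / 1) (b / 1) ⟨
  ℚ.toℚᵘ ((a / 1) ℚ.* (b / 1))            ∎)
  where open SetoidReasoning ℚᵘ.≃-setoid

module RingOfIntegers (K : NumberField c ℓ₁ ℓ₂) where

  open NumberField K
  open RingProperties (CommutativeRing.ring commutativeRing) using (-1*x≈-x)
  open IntegralClosure commutativeRing
  private module ι = IsRingHomomorphism ι-homo

  IsInteger : Pred Carrier ℓ₁
  IsInteger x = ∃[ k ] x ≈ ιℤ k

  isSubring-ℤ : IsSubring IsInteger
  isSubring-ℤ = record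
    { resp = λ { p (k , q) → k , trans (sym p) q }
    ; 0∈   = + 0 , sym ι.0#-homo
    ; 1∈   = + 1 , sym ι.1#-homo
    ; +∈   = λ { (j , p) (k , q) → j ℤ.+ k , trans (+-cong p q)
               (trans (sym (ι.+-homo (j / 1) (k / 1))) (reflexive (≡.cong ι (≡.sym (fromℤ-+ j k))))) }
    ; *∈   = λ { (j , p) (k , q) → j ℤ.* k , trans (CommutativeRing.*-cong commutativeRing p q)
               (trans (sym (ι.*-homo (j / 1) (k / 1))) (reflexive (≡.cong ι (≡.sym (fromℤ-* j k))))) }
    ; -1∈  = -[1+ 0 ] , trans (-‿cong (sym ι.1#-homo)) (sym (ι.-‿homo ℚ.1ℚ))
    }

  module _ (x : Carrier) where

    open Polys isSubring-ℤ x
    open Sum semiring using (*-distribˡ-sum; sum-cong-≋)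
    open SetoidReasoning setoid
    open SemiringSolver (CommutativeRing.commutativeSemiring commutativeRing)
      using (solve; _:*_; _:=_)

    eval : ∀ n → Vector ℤ n → Carrier
    eval n a = sum (λ i → ιℤ (a i) * x ^ toℕ i)

    eval-suc : ∀ n (a : Vector ℤ (suc n)) →
               eval (suc n) a ≈ ιℤ (a Fin.zero) + x * eval n (λ i → a (Fin.suc i))
    eval-suc n a = +-cong (*-identityʳ _) (begin
      sum (λ i → ιℤ (a (Fin.suc i)) * (x * x ^ toℕ i))   ≈⟨ sum-cong-≋ {n} (λ i →
        solve 3 (λ u v w → u :* (v :* w) := v :* (u :* w)) refl _ x _) ⟩
      sum (λ i → x * (ιℤ (a (Fin.suc i)) * x ^ toℕ i))   ≈⟨ *-distribˡ-sum {n} x _ ⟨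
      x * eval n (λ i → a (Fin.suc i))                   ∎)

    eval-low : ∀ n a → Low n (eval n a)
    eval-low zero    a = Level.lift refl
    eval-low (suc n) a = ιℤ (a Fin.zero) , _ , (a Fin.zero , refl) ,
      eval-low n (λ i → a (Fin.suc i)) , eval-suc n a

    low-eval : ∀ n {y} → Low n y → Σ[ a ∈ Vector ℤ n ] y ≈ eval n a
    low-eval zero    (Level.lift p) = (λ ()) , p
    low-eval (suc n) (_ , _ , (k , q) , l , p) with low-eval n l
    ... | a , r = a′ , trans p (trans (+-cong q (*-congˡ r)) (sym (eval-suc n a′)))
      where
      a′ : Vector ℤ (suc n)
      a′ Fin.zero    = k
      a′ (Fin.suc i) = a i

    integral⇒ : Integral x → IntegralOver isSubring-ℤ x
    integral⇒ (n , a , p) = n , eval n a , eval-low n a , sym p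

    integral⇐ : IntegralOver isSubring-ℤ x → Integral x
    integral⇐ (n , y , l , p) with low-eval n l
    ... | a , q = n , a , trans (+-congˡ (sym q)) (sym p)

  private module C = IsSubring (isSubring-closure isSubring-ℤ)

  𝓞-rawRing : RawRing (c ⊔ ℓ₁) ℓ₁
  𝓞-rawRing = record
    { Carrier = ∃ Integral
    ; _≈_     = λ x y → proj₁ x ≈ proj₁ y
    ; _+_     = λ { (x , p) (y , q) → x + y ,
                  integral⇐ (x + y) (C.+∈ (integral⇒ x p) (integral⇒ y q)) }
    ; _*_     = λ { (x , p) (y , q) → x * y ,
                  integral⇐ (x * y) (C.*∈ (integral⇒ x p) (integral⇒ y q)) }
    ; -_      = λ { (x , p) → - x ,
                  integral⇐ (- x) (C.resp (-1*x≈-x x) (C.*∈ C.-1∈ (integral⇒ x p))) }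
    ; 0#      = 0# , integral⇐ 0# C.0∈
    ; 1#      = 1# , integral⇐ 1# C.1∈
    }

  inclusion : IsRingMonomorphism 𝓞-rawRing rawRing proj₁
  inclusion = record
    { isRingHomomorphism = record
      { isSemiringHomomorphism = record
        { isNearSemiringHomomorphism = record
          { +-isMonoidHomomorphism = record
            { isMagmaHomomorphism = record
              { isRelHomomorphism = record { cong = λ p → p }
              ; homo = λ _ _ → refl }
            ; ε-homo = refl }
          ; *-homo = λ _ _ → refl }
        ; 1#-homo = refl }
      ; -‿homo = λ _ → refl }
    ; injective = λ p → p
    }

  𝓞 : CommutativeRing (c ⊔ ℓ₁) ℓ₁
  𝓞 = record { isCommutativeRing =
    RingMonomorphism.isCommutativeRing inclusion isCommutativeRing }

open RingOfIntegers public using (𝓞)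

module Ideals (R : CommutativeRing c ℓ) where

  open CommutativeRing R
  open SemiringSolver commutativeSemiring using (solve; _:+_; _:*_; _:=_)

  record Ideal : Set (lsuc (c ⊔ ℓ)) where
    field
      member   : Pred Carrier (c ⊔ ℓ)
      resp     : member Respects _≈_
      0∈       : member 0#
      +-closed : ∀ {x y} → member x → member y → member (x + y)
      *-closed : ∀ r {x} → member x → member (r * x)

  open Ideal

  infix 4 _≈ᴵ_ _∈ᴵ_

  _∈ᴵ_ : Carrier → Ideal → Set (c ⊔ ℓ)
  x ∈ᴵ I = member I x

  _≈ᴵ_ : Ideal → Ideal → Set (c ⊔ ℓ)
  I ≈ᴵ J = member I ≐ member J

  ⟨_⟩ : Carrier → Ideal
  ⟨ a ⟩ = record
    { member   = λ x → ∃[ r ] r * a ≈ x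
    ; resp     = λ { p (q , e) → q , trans e p }
    ; 0∈       = 0# , zeroˡ a
    ; +-closed = λ { (p , d) (q , e) → p + q , trans (distribʳ a p q) (+-cong d e) }
    ; *-closed = λ { r (q , e) → r * q , trans (*-assoc r q a) (*-congˡ e) }
    }

  -- Finite sums a₁b₁ + ⋯ + aₙbₙ with aᵢ ∈ I and bᵢ ∈ J.
  data ProductMember (I J : Ideal) : Pred Carrier (c ⊔ ℓ) where
    nil  : ∀ {x} → x ≈ 0# → ProductMember I J x
    cons : ∀ {x a b y} → a ∈ᴵ I → b ∈ᴵ J → ProductMember I J y →
           x ≈ a * b + y → ProductMember I J x

  infixl 7 _·_

  _·_ : Ideal → Ideal → Ideal
  I · J = record
    { member   = ProductMember I J
    ; resp     = rsp
    ; 0∈       = nil refl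
    ; +-closed = add
    ; *-closed = scale
    }
    where
    rsp : ProductMember I J Respects _≈_
    rsp p (nil q)         = nil (trans (sym p) q)
    rsp p (cons a b ps q) = cons a b ps (trans (sym p) q)

    add : ∀ {x y} → ProductMember I J x → ProductMember I J y → ProductMember I J (x + y)
    add (nil p)         qs = rsp (sym (trans (+-congʳ p) (+-identityˡ _))) qs
    add (cons a b ps p) qs = cons a b (add ps qs) (trans (+-congʳ p) (+-assoc _ _ _))

    scale : ∀ r {x} → ProductMember I J x → ProductMember I J (r * x)
    scale r (nil p)         = nil (trans (*-congˡ p) (zeroʳ r))
    scale r (cons a b ps p) = cons (*-closed I r a) b (scale r ps)
      (trans (*-congˡ p)
        (solve 4 (λ r a b y → r :* (a :* b :+ y) := (r :* a) :* b :+ r :* y) refl r _ _ _))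

  private
    ·-rawMonoid : RawMonoid (lsuc (c ⊔ ℓ)) (c ⊔ ℓ)
    ·-rawMonoid = record { Carrier = Ideal ; _≈_ = _≈ᴵ_ ; _∙_ = _·_ ; ε = ⟨ 1# ⟩ }

    module M = RawMonoidDefs ·-rawMonoid

  infixr 8 _^ᴵ_

  _^ᴵ_ : Ideal → ℕ → Ideal
  I ^ᴵ n = n M.× I

  ∏ : ∀ {n} → Vector Ideal n → Ideal
  ∏ = M.sum

  record IsPrime (P : Ideal) : Set (c ⊔ ℓ) where
    field
      proper : ¬ 1# ∈ᴵ P
      prime  : ∀ {x y} → x * y ∈ᴵ P → x ∈ᴵ P ⊎ y ∈ᴵ P

  -- The 𝔭 i are automatically non-zero when I is: a zero factor with positive
  -- exponent would make the product zero.
  record PrimeFactorization (I : Ideal) : Set (lsuc (c ⊔ ℓ)) where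
    field
      g        : ℕ
      𝔭        : Vector Ideal g
      e        : Vector ℕ g
      primes   : ∀ i → IsPrime (𝔭 i)
      distinct : Injective _≡_ _≈ᴵ_ 𝔭
      positive : ∀ i → 0 ℕ.< e i
      factors  : I ≈ᴵ ∏ (λ i → 𝔭 i ^ᴵ e i)

  -- The factorization of I is unique up to order in a ring of integers, so it
  -- does not matter that each divisor J carries its own.
  IsIdealDivisor : Ideal → Ideal → Set (lsuc (c ⊔ ℓ))
  IsIdealDivisor J I = Σ[ F ∈ PrimeFactorization I ] let open PrimeFactorization F in
    Σ[ f ∈ Vector ℕ g ] (∀ i → f i ℕ.≤ e i) × J ≈ᴵ ∏ (λ i → 𝔭 i ^ᴵ f i)

  IsPrincipal : Ideal → Set (c ⊔ ℓ)
  IsPrincipal J = ∃[ a ] J ≈ᴵ ⟨ a ⟩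

  principalIdealDivisors : Carrier → Setoid (lsuc (c ⊔ ℓ)) (c ⊔ ℓ)
  principalIdealDivisors α = record
    { Carrier       = Σ[ J ∈ Ideal ] IsIdealDivisor J ⟨ α ⟩ × IsPrincipal J
    ; _≈_           = λ J J′ → proj₁ J ≈ᴵ proj₁ J′
    ; isEquivalence = record
      { refl  = (λ x∈ → x∈) , (λ x∈ → x∈)
      ; sym   = λ { (p , q) → q , p }
      ; trans = λ { (p , q) (p′ , q′) → (λ x∈ → p′ (p x∈)) , (λ x∈ → q (q′ x∈)) }
      }
    }

  -- Ideals are counted up to equality of their sets of elements.
  n⟨_⟩≡_ : Carrier → ℕ → Set (lsuc (c ⊔ ℓ))
  n⟨ α ⟩≡ k = Inverse (≡.setoid (Fin k)) (principalIdealDivisors α)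

{-# OPTIONS --safe #-}

-- If α = x y then ⟨x⟩ is an ideal divisor of ⟨α⟩: each prime ideal in the
-- factorization of ⟨α⟩ = ⟨x⟩⟨y⟩ contains one of the two factors and, dividing
-- the principal ideal ⟨α⟩, can be cancelled from it.  The intermediate
-- cofactors are no longer principal, but as divisors of ⟨α⟩ they are finitely
-- generated, so primality still decides which of them lies in the next prime.
-- Hence ⟨1⟩, ⟨x⟩ and ⟨α⟩ are principal ideal divisors.  There are only two, and
-- ⟨1⟩ ≠ ⟨α⟩, so either ⟨x⟩ = ⟨1⟩ and x is a unit, or ⟨x⟩ = ⟨α⟩ and y is a unit.
module Submission where

open import Algebra.Bundles using (CommutativeMonoid; CommutativeRing; RawRing)
open import Algebra.Definitions.RawMagma using (_,_)
open import Algebra.Definitions.RawSemiring using (Irreducible)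
import Algebra.Properties.CommutativeSemigroup as CommutativeSemigroupProperties
import Algebra.Properties.Ring as RingProperties
open import Data.Empty using (⊥-elim)
open import Data.Fin.Base using (Fin; zero; suc)
open import Data.List.Base using (List; []; _∷_)
open import Data.List.Relation.Unary.All as All using (All; []; _∷_)
open import Data.Nat.Base using (ℕ; zero; suc; _≤_; z≤n; s≤s)
open import Data.Nat.Properties using (m≤n⇒m≤1+n)
open import Data.Product.Base using (Σ-syntax; ∃-syntax; _×_; _,_; proj₁; proj₂)
open import Data.Sum.Base as Sum using (_⊎_; inj₁; inj₂)
open import Data.Vec.Functional using (Vector)
open import Function.Base using (_∘_)
open import Function.Bundles using (Inverse)
open import Level using (Level; _⊔_) renaming (suc to lsuc)
open import Relation.Binary.Bundles using (Setoid)
open import Relation.Binary.PropositionalEquality as ≡ using (_≡_; _≢_)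
import Relation.Binary.Reasoning.Setoid as SetoidReasoning
open import Relation.Nullary.Negation using (¬_)
open import Defs

-- Finite case distinctions on lists and on a two-element set.

private variable
  a b p : Level

All-⊎ : {A : Set a} {B : Set b} {P : A → Set p} {xs : List A} →
        All (λ x → P x ⊎ B) xs → All P xs ⊎ B
All-⊎ []              = inj₁ []
All-⊎ (inj₂ b ∷ _)    = inj₂ b
All-⊎ (inj₁ px ∷ pxs) = Sum.map₁ (px ∷_) (All-⊎ pxs)

Fin2-exhausted : {i j : Fin 2} → i ≢ j → ∀ k → k ≡ i ⊎ k ≡ j
Fin2-exhausted {zero}     {zero}     i≢j k = ⊥-elim (i≢j ≡.refl)
Fin2-exhausted {suc zero} {suc zero} i≢j k = ⊥-elim (i≢j ≡.refl)
Fin2-exhausted {zero}     {suc zero} i≢j zero       = inj₁ ≡.refl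
Fin2-exhausted {zero}     {suc zero} i≢j (suc zero) = inj₂ ≡.refl
Fin2-exhausted {suc zero} {zero}     i≢j zero       = inj₂ ≡.refl
Fin2-exhausted {suc zero} {zero}     i≢j (suc zero) = inj₁ ≡.refl

-- Products, powers and inclusions of ideals in a commutative ring.

module IdealProperties {c ℓ} (R : CommutativeRing c ℓ) where

  open CommutativeRing R hiding (zero)
  open Ideals R
  open Ideal
  open CommutativeSemigroupProperties *-commutativeSemigroup using (x∙yz≈y∙xz; xy∙z≈xz∙y)

  infix 4 _⊆ᴵ_

  _⊆ᴵ_ : Ideal → Ideal → Set (c ⊔ ℓ)
  I ⊆ᴵ J = ∀ {x} → x ∈ᴵ I → x ∈ᴵ J

  *-closedʳ : ∀ I {x} r → x ∈ᴵ I → x * r ∈ᴵ I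
  *-closedʳ I r x∈ = resp I (*-comm r _) (*-closed I r x∈)

  ∈-· : ∀ I J {x y} → x ∈ᴵ I → y ∈ᴵ J → x * y ∈ᴵ I · J
  ∈-· I J x∈ y∈ = cons x∈ y∈ (nil refl) (sym (+-identityʳ _))

  ·-least : ∀ I J L → (∀ {x y} → x ∈ᴵ I → y ∈ᴵ J → x * y ∈ᴵ L) → I · J ⊆ᴵ L
  ·-least I J L f (nil x≈0) = resp L (sym x≈0) (0∈ L)
  ·-least I J L f (cons a∈ b∈ y∈ e) =
    resp L (sym e) (+-closed L (f a∈ b∈) (·-least I J L f y∈))

  ·-mono : ∀ I I′ J J′ → I ⊆ᴵ I′ → J ⊆ᴵ J′ → I · J ⊆ᴵ I′ · J′
  ·-mono I I′ J J′ f g = ·-least I J (I′ · J′) (λ x∈ y∈ → ∈-· I′ J′ (f x∈) (g y∈))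

  ·-⊆ʳ : ∀ I J → I · J ⊆ᴵ J
  ·-⊆ʳ I J = ·-least I J J (λ {x} _ y∈ → *-closed J x y∈)

  ·-comm-⊆ : ∀ I J → I · J ⊆ᴵ J · I
  ·-comm-⊆ I J = ·-least I J (J · I) (λ x∈ y∈ → resp (J · I) (*-comm _ _) (∈-· J I y∈ x∈))

  ·-⊆ˡ : ∀ I J → I · J ⊆ᴵ I
  ·-⊆ˡ I J x∈ = ·-⊆ʳ J I (·-comm-⊆ I J x∈)

  -- The colon ideal (I : a). It reduces conditions on sums to conditions on products in the
  -- associativity proof, and later divides an ideal by `α`.
  _/ᴵ_ : Ideal → Carrier → Ideal
  I /ᴵ a = record
    { member   = λ z → z * a ∈ᴵ I
    ; resp     = λ e → resp I (*-congʳ e)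
    ; 0∈       = resp I (sym (zeroˡ a)) (0∈ I)
    ; +-closed = λ x∈ y∈ → resp I (sym (distribʳ a _ _)) (+-closed I x∈ y∈)
    ; *-closed = λ r x∈ → resp I (sym (*-assoc r _ a)) (*-closed I r x∈)
    }

  ·-assoc-⊆ : ∀ I J L → (I · J) · L ⊆ᴵ I · (J · L)
  ·-assoc-⊆ I J L = ·-least (I · J) L (I · (J · L)) λ xy∈ z∈ →
    -- For fixed z, the w with w * z in the target form a colon ideal, so it suffices to treat w = x
    -- * y.
    ·-least I J ((I · (J · L)) /ᴵ _)
      (λ x∈ y∈ → resp (I · (J · L)) (sym (*-assoc _ _ _)) (∈-· I (J · L) x∈ (∈-· J L y∈ z∈)))
      xy∈

  -- The inclusion above with I and L exchanged, transported by commutativity.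
  ·-assoc-⊇ : ∀ I J L → I · (J · L) ⊆ᴵ (I · J) · L
  ·-assoc-⊇ I J L =
    ·-comm-⊆ L (I · J) ∘ ·-mono L L (J · I) (I · J) (λ x∈ → x∈) (·-comm-⊆ J I) ∘
    ·-assoc-⊆ L J I ∘ ·-mono (J · L) (L · J) I I (·-comm-⊆ J L) (λ x∈ → x∈) ∘
    ·-comm-⊆ I (J · L)

  ⊆-⟨1⟩ : ∀ I → I ⊆ᴵ ⟨ 1# ⟩
  ⊆-⟨1⟩ I _ = _ , *-identityʳ _

  ⟨⟩-least : ∀ I {x} → x ∈ᴵ I → ⟨ x ⟩ ⊆ᴵ I
  ⟨⟩-least I x∈ (r , e) = resp I e (*-closed I r x∈)

  x∈⟨x⟩ : ∀ x → x ∈ᴵ ⟨ x ⟩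
  x∈⟨x⟩ x = 1# , *-identityˡ x

  ⟨⟩-· : ∀ {x y z} → z ≈ x * y → ⟨ x ⟩ · ⟨ y ⟩ ≈ᴵ ⟨ z ⟩
  ⟨⟩-· {x} {y} {z} z≈xy =
    ·-least ⟨ x ⟩ ⟨ y ⟩ ⟨ z ⟩
      (λ { (r , e) y∈ → resp ⟨ z ⟩ (trans (sym (*-assoc r x _)) (*-congʳ e))
             (*-closed ⟨ z ⟩ r (x*∈ y∈)) }) ,
    ⟨⟩-least (⟨ x ⟩ · ⟨ y ⟩)
      (resp (⟨ x ⟩ · ⟨ y ⟩) (sym z≈xy) (∈-· ⟨ x ⟩ ⟨ y ⟩ (x∈⟨x⟩ x) (x∈⟨x⟩ y)))
    where
    x*∈ : ∀ {t} → t ∈ᴵ ⟨ y ⟩ → x * t ∈ᴵ ⟨ z ⟩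
    x*∈ (s , e) = s , trans (trans (*-congˡ z≈xy) (x∙yz≈y∙xz s x y)) (*-congˡ e)

  -- Each term (t * a) * b of the sum equals (t * b) * a, so the sum collapses to a single multiple
  -- of a.
  ∈-⟨⟩· : ∀ a I {z} → z ∈ᴵ ⟨ a ⟩ · I → ∃[ r ] r ∈ᴵ I × r * a ≈ z
  ∈-⟨⟩· a I (nil e) = 0# , 0∈ I , trans (zeroˡ a) (sym e)
  ∈-⟨⟩· a I (cons {a = s} {b} (t , ta≈s) b∈ y∈ e) with ∈-⟨⟩· a I y∈
  ... | r , r∈ , ra≈y = t * b + r , +-closed I (*-closed I t b∈) r∈ , (begin
    (t * b + r) * a     ≈⟨ distribʳ a (t * b) r ⟩
    t * b * a + r * a   ≈⟨ +-cong (trans (xy∙z≈xz∙y t b a) (*-congʳ ta≈s)) ra≈y ⟩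
    s * b + _           ≈⟨ e ⟨
    _                   ∎)
    where open SetoidReasoning setoid

  ·-commutativeMonoid : CommutativeMonoid (lsuc (c ⊔ ℓ)) (c ⊔ ℓ)
  ·-commutativeMonoid = record
    { Carrier = Ideal
    ; _≈_     = _≈ᴵ_
    ; _∙_     = _·_
    ; ε       = ⟨ 1# ⟩
    ; isCommutativeMonoid = record
      { isMonoid = record
        { isSemigroup = record
          { isMagma = record
            { isEquivalence = record
              { refl  = (λ x∈ → x∈) , (λ x∈ → x∈)
              ; sym   = λ { (f , g) → g , f }
              ; trans = λ { (f , g) (f′ , g′) → f′ ∘ f , g ∘ g′ }
              }
            ; ∙-cong = λ { {I} {I′} {J} {J′} (f , g) (f′ , g′) →
                ·-mono I I′ J J′ f f′ , ·-mono I′ I J′ J g g′ }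
            }
          ; assoc = λ I J L → ·-assoc-⊆ I J L , ·-assoc-⊇ I J L
          }
        ; identity = (λ I → ·-⊆ʳ ⟨ 1# ⟩ I , ⟨1⟩·-⊇ I) ,
                     (λ I → ·-⊆ˡ I ⟨ 1# ⟩ , ·-comm-⊆ ⟨ 1# ⟩ I ∘ ⟨1⟩·-⊇ I)
        }
      ; comm = λ I J → ·-comm-⊆ I J , ·-comm-⊆ J I
      }
    }
    where
    ⟨1⟩·-⊇ : ∀ I → I ⊆ᴵ ⟨ 1# ⟩ · I
    ⟨1⟩·-⊇ I x∈ = resp (⟨ 1# ⟩ · I) (*-identityˡ _) (∈-· ⟨ 1# ⟩ I (x∈⟨x⟩ 1#) x∈)

  ^ᴵ-antimono : ∀ P {m n} → m ≤ n → P ^ᴵ n ⊆ᴵ P ^ᴵ m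
  ^ᴵ-antimono P {n = n} z≤n             = ⊆-⟨1⟩ (P ^ᴵ n)
  ^ᴵ-antimono P {suc m} {suc n} (s≤s m≤n) =
    ·-mono P P (P ^ᴵ n) (P ^ᴵ m) (λ x∈ → x∈) (^ᴵ-antimono P m≤n)

  ∏-mono : ∀ {g} (I J : Vector Ideal g) → (∀ i → I i ⊆ᴵ J i) → ∏ I ⊆ᴵ ∏ J
  ∏-mono {zero}  I J f = λ x∈ → x∈
  ∏-mono {suc g} I J f = ·-mono (I zero) (J zero) (∏ (I ∘ suc)) (∏ (J ∘ suc))
    (f zero) (∏-mono (I ∘ suc) (J ∘ suc) (λ i → f (suc i)))

  -- Lowering exponents enlarges a product of powers: to divide is to contain.
  ideal-divisor-⊇ : ∀ I J → IsIdealDivisor J I → I ⊆ᴵ J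
  ideal-divisor-⊇ I J (F , f , f≤e , J≈) x∈ =
    proj₂ J≈ (∏-mono (λ i → 𝔭 i ^ᴵ e i) (λ i → 𝔭 i ^ᴵ f i)
      (λ i → ^ᴵ-antimono (𝔭 i) (f≤e i)) (proj₁ factors x∈))
    where open PrimeFactorization F

  module _ {P} (P-prime : IsPrime P) where

    open IsPrime P-prime

    -- Constructively, an x outside `P` cannot simply be picked. Instead, running `prime` over all
    -- of ys shows for each x that x lies in `P` or all of ys does; a second pass over xs combines
    -- these answers.
    prime-lists : ∀ xs ys → All (λ x → All (λ y → x * y ∈ᴵ P) ys) xs →
                  All (_∈ᴵ P) xs ⊎ All (_∈ᴵ P) ys
    prime-lists xs ys = All-⊎ ∘ All.map (Sum.swap ∘ All-⊎ ∘ All.map (Sum.swap ∘ prime))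

  -- Ideals dividing a principal ideal with cancellable generator.

  module Divisors (α : Carrier) (α-cancel : ∀ x y → x * α ≈ y * α → x ≈ y) where

    private module · = CommutativeMonoid ·-commutativeMonoid
    open CommutativeSemigroupProperties ·.commutativeSemigroup
      using () renaming (x∙yz≈y∙xz to ·-x∙yz≈y∙xz)

    ⟨α⟩ : Ideal
    ⟨α⟩ = ⟨ α ⟩

    -- The cofactor is an inverse of I up to the factor `α`; it takes the place of an inverse
    -- fractional ideal.
    Divisor : Ideal → Set (lsuc (c ⊔ ℓ))
    Divisor I = ∃[ J ] I · J ≈ᴵ ⟨α⟩

    divisor-resp : ∀ I J → I ≈ᴵ J → Divisor I → Divisor J
    divisor-resp I J I≈J (Q , IQ≈α) = Q , (begin
      J · Q   ≈⟨ ·.∙-congʳ I≈J ⟨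
      I · Q   ≈⟨ IQ≈α ⟩
      ⟨α⟩     ∎)
      where open SetoidReasoning ·.setoid

    divisorˡ : ∀ I J → Divisor (I · J) → Divisor I
    divisorˡ I J (Q , e) = J · Q , (begin
      I · (J · Q)   ≈⟨ ·.assoc I J Q ⟨
      I · J · Q     ≈⟨ e ⟩
      ⟨α⟩           ∎)
      where open SetoidReasoning ·.setoid

    divisorʳ : ∀ I J → Divisor (I · J) → Divisor J
    divisorʳ I J d = divisorˡ J I (divisor-resp (I · J) (J · I) (·.comm I J) d)

    α-cancel-⊆ : ∀ I J → ⟨α⟩ · I ⊆ᴵ ⟨α⟩ · J → I ⊆ᴵ J
    α-cancel-⊆ I J f {z} z∈ with ∈-⟨⟩· α J (f (∈-· ⟨α⟩ I (x∈⟨x⟩ α) z∈))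
    ... | r , r∈ , rα≈αz = resp J (α-cancel r z (trans rα≈αz (*-comm α z))) r∈

    α-cancelᴵ : ∀ I J → ⟨α⟩ · I ≈ᴵ ⟨α⟩ · J → I ≈ᴵ J
    α-cancelᴵ I J (f , g) = α-cancel-⊆ I J f , α-cancel-⊆ J I g

    -- Multiplying by the cofactor B turns A into `⟨α⟩`, which can be cancelled.
    ·-cancelˡ : ∀ A I J → Divisor A → A · I ≈ᴵ A · J → I ≈ᴵ J
    ·-cancelˡ A I J (B , AB≈α) AI≈AJ = α-cancelᴵ I J (begin
      ⟨α⟩ · I       ≈⟨ α· I ⟩
      B · (A · I)   ≈⟨ ·.∙-congˡ AI≈AJ ⟩
      B · (A · J)   ≈⟨ α· J ⟨
      ⟨α⟩ · J       ∎)
      where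
      open SetoidReasoning ·.setoid

      α· : ∀ L → ⟨α⟩ · L ≈ᴵ B · (A · L)
      α· L = begin
        ⟨α⟩ · L       ≈⟨ ·.∙-congʳ AB≈α ⟨
        A · B · L     ≈⟨ ·.assoc A B L ⟩
        A · (B · L)   ≈⟨ ·-x∙yz≈y∙xz A B L ⟩
        B · (A · L)   ∎

    -- Since Q · X lies in Q · P = `⟨α⟩`, all its elements are multiples of `α`; the quotient sought
    -- is Q · X divided by `α`.
    contains⇒divides : ∀ P X → Divisor P → X ⊆ᴵ P → ∃[ X′ ] X ≈ᴵ P · X′
    contains⇒divides P X (Q , PQ≈α) X⊆P = X′ , α-cancelᴵ X (P · X′) (begin
      ⟨α⟩ · X            ≈⟨ ·.∙-congʳ PQ≈α ⟨
      P · Q · X          ≈⟨ ·.assoc P Q X ⟩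
      P · (Q · X)        ≈⟨ ·.∙-congˡ QX≈αX′ ⟩
      P · (⟨α⟩ · X′)     ≈⟨ ·-x∙yz≈y∙xz P ⟨α⟩ X′ ⟩
      ⟨α⟩ · (P · X′)     ∎)
      where
      open SetoidReasoning ·.setoid

      X′ : Ideal
      X′ = (Q · X) /ᴵ α

      QX⊆α : Q · X ⊆ᴵ ⟨α⟩
      QX⊆α = proj₁ PQ≈α ∘ ·-comm-⊆ Q P ∘ ·-mono Q Q X P (λ x∈ → x∈) X⊆P

      QX≈αX′ : Q · X ≈ᴵ ⟨α⟩ · X′
      QX≈αX′ =
        (λ x∈ → let (r , rα≈x) = QX⊆α x∈ in
          resp (⟨α⟩ · X′) (trans (*-comm α r) rα≈x)
            (∈-· ⟨α⟩ X′ (x∈⟨x⟩ α) (resp (Q · X) (sym rα≈x) x∈))) ,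
        (λ x∈ → let (r , rα∈ , rα≈x) = ∈-⟨⟩· α X′ x∈ in resp (Q · X) rα≈x rα∈)

    -- If α = Σ aᵢbᵢ with aᵢ ∈ X and bᵢ in the cofactor A, then for z ∈ X each
    -- z bᵢ is a multiple rᵢα of α, whence z = Σ aᵢrᵢ: the aᵢ generate X.
    finitely-generated : ∀ X → Divisor X → Σ[ xs ∈ List Carrier ]
      All (_∈ᴵ X) xs × (∀ J → All (_∈ᴵ J) xs → X ⊆ᴵ J)
    finitely-generated X (A , XA≈α) = gens α∈XA , gens∈ α∈XA , λ J all {z} z∈ →
      let (r , r∈ , rα≈zα) = combine J α∈XA all z∈ in resp J (α-cancel r z rα≈zα) r∈
      where
      α∈XA : α ∈ᴵ X · A
      α∈XA = proj₂ XA≈α (x∈⟨x⟩ α)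

      gens : ∀ {w} → w ∈ᴵ X · A → List Carrier
      gens (nil _)                 = []
      gens (cons {a = a} _ _ w∈ _) = a ∷ gens w∈

      gens∈ : ∀ {w} (w∈ : w ∈ᴵ X · A) → All (_∈ᴵ X) (gens w∈)
      gens∈ (nil _)          = []
      gens∈ (cons a∈ _ w∈ _) = a∈ ∷ gens∈ w∈

      -- Generalised from `α` to every tail w of the sum, so that recursion applies; each term
      -- contributes z * (a * b) = (a * s) * α.
      combine : ∀ J {w} (w∈ : w ∈ᴵ X · A) → All (_∈ᴵ J) (gens w∈) →
                ∀ {z} → z ∈ᴵ X → ∃[ r ] r ∈ᴵ J × r * α ≈ z * w
      combine J (nil w≈0) [] {z} z∈ =
        0# , 0∈ J , trans (zeroˡ α) (sym (trans (*-congˡ w≈0) (zeroʳ z)))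
      combine J {w} (cons {a = a} {b} {y} a∈ b∈ y∈ e) (a∈J ∷ all) {z} z∈
        with combine J y∈ all z∈ | proj₁ XA≈α (∈-· X A z∈ b∈)
      ... | r , r∈ , rα≈zy | s , sα≈zb =
        a * s + r , +-closed J (*-closedʳ J s a∈J) r∈ , (begin
          (a * s + r) * α       ≈⟨ distribʳ α (a * s) r ⟩
          a * s * α + r * α     ≈⟨ +-cong (trans (*-assoc a s α) (*-congˡ sα≈zb)) rα≈zy ⟩
          a * (z * b) + z * y   ≈⟨ +-congʳ (x∙yz≈y∙xz a z b) ⟩
          z * (a * b) + z * y   ≈⟨ distribˡ z (a * b) y ⟨
          z * (a * b + y)       ≈⟨ *-congˡ e ⟨
          z * w                 ∎)
        where open SetoidReasoning setoid

    -- Taking prime ideals out of a product of two divisors.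

    prime-divisors : ∀ {P} X Y → IsPrime P → Divisor X → Divisor Y →
                     X · Y ⊆ᴵ P → X ⊆ᴵ P ⊎ Y ⊆ᴵ P
    prime-divisors {P} X Y P-prime dX dY XY⊆P =
      let (xs , xs∈ , xs-generate) = finitely-generated X dX
          (ys , ys∈ , ys-generate) = finitely-generated Y dY
      in Sum.map (xs-generate P) (ys-generate P)
           (prime-lists P-prime xs ys
             (All.map (λ x∈ → All.map (λ y∈ → XY⊆P (∈-· X Y x∈ y∈)) ys∈) xs∈))

    -- `P` is taken out of whichever factor lies in it. Only a split of X is recorded, because only
    -- the exponents of X are wanted.
    divide-prime : ∀ {P} Q X Y → IsPrime P → Divisor (P · Q) → X · Y ≈ᴵ P · Q →
                   (∃[ X′ ] X ≈ᴵ P · X′ × X′ · Y ≈ᴵ Q) ⊎ (∃[ Y′ ] X · Y′ ≈ᴵ Q)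
    divide-prime {P} Q X Y P-prime dPQ XY≈PQ = Sum.map fromˡ fromʳ
      (prime-divisors X Y P-prime (divisorˡ X Y dXY) (divisorʳ X Y dXY)
        (·-⊆ˡ P Q ∘ proj₁ XY≈PQ))
      where
      open SetoidReasoning ·.setoid

      dXY : Divisor (X · Y)
      dXY = divisor-resp (P · Q) (X · Y) (·.sym {X · Y} {P · Q} XY≈PQ) dPQ

      dP : Divisor P
      dP = divisorˡ P Q dPQ

      fromˡ : X ⊆ᴵ P → ∃[ X′ ] X ≈ᴵ P · X′ × X′ · Y ≈ᴵ Q
      fromˡ X⊆P with contains⇒divides P X dP X⊆P
      ... | X′ , X≈PX′ = X′ , X≈PX′ , ·-cancelˡ P (X′ · Y) Q dP (begin
        P · (X′ · Y)   ≈⟨ ·.assoc P X′ Y ⟨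
        P · X′ · Y     ≈⟨ ·.∙-congʳ X≈PX′ ⟨
        X · Y          ≈⟨ XY≈PQ ⟩
        P · Q          ∎)

      fromʳ : Y ⊆ᴵ P → ∃[ Y′ ] X · Y′ ≈ᴵ Q
      fromʳ Y⊆P with contains⇒divides P Y dP Y⊆P
      ... | Y′ , Y≈PY′ = Y′ , ·-cancelˡ P (X · Y′) Q dP (begin
        P · (X · Y′)   ≈⟨ ·-x∙yz≈y∙xz P X Y′ ⟩
        X · (P · Y′)   ≈⟨ ·.∙-congˡ Y≈PY′ ⟨
        X · Y          ≈⟨ XY≈PQ ⟩
        P · Q          ∎)

    -- f counts the copies of `P` taken out of X; the other copies come out of Y.
    divide-prime-power : ∀ {P} e Q X Y → IsPrime P → Divisor (P ^ᴵ e · Q) →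
                         X · Y ≈ᴵ P ^ᴵ e · Q →
                         Σ[ f ∈ ℕ ] ∃[ X′ ] ∃[ Y′ ]
                           f ≤ e × X ≈ᴵ P ^ᴵ f · X′ × X′ · Y′ ≈ᴵ Q
    divide-prime-power zero Q X Y P-prime d XY≈Q =
      0 , X , Y , z≤n , ·.sym {⟨ 1# ⟩ · X} {X} (·.identityˡ X) ,
      ·.trans {X · Y} {⟨ 1# ⟩ · Q} {Q} XY≈Q (·.identityˡ Q)
    divide-prime-power {P} (suc e) Q X Y P-prime d XY≈ =
      Sum.[ fromˡ , fromʳ ] (divide-prime (P ^ᴵ e · Q) X Y P-prime
        (divisor-resp (P · P ^ᴵ e · Q) (P · (P ^ᴵ e · Q)) assoc d)
        (·.trans {X · Y} {P · P ^ᴵ e · Q} {P · (P ^ᴵ e · Q)} XY≈ assoc))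
      where
      open SetoidReasoning ·.setoid

      assoc = ·.assoc P (P ^ᴵ e) Q

      dQ : Divisor (P ^ᴵ e · Q)
      dQ = divisorʳ P (P ^ᴵ e · Q)
        (divisor-resp (P · P ^ᴵ e · Q) (P · (P ^ᴵ e · Q)) assoc d)

      fromˡ : ∃[ X₁ ] X ≈ᴵ P · X₁ × X₁ · Y ≈ᴵ P ^ᴵ e · Q → _
      fromˡ (X₁ , X≈PX₁ , X₁Y≈) with divide-prime-power e Q X₁ Y P-prime dQ X₁Y≈
      ... | f , X′ , Y′ , f≤e , X₁≈ , X′Y′≈Q =
        suc f , X′ , Y′ , s≤s f≤e , (begin
          X                    ≈⟨ X≈PX₁ ⟩
          P · X₁               ≈⟨ ·.∙-congˡ X₁≈ ⟩
          P · (P ^ᴵ f · X′)    ≈⟨ ·.assoc P (P ^ᴵ f) X′ ⟨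
          P · P ^ᴵ f · X′      ∎) , X′Y′≈Q

      fromʳ : ∃[ Y₁ ] X · Y₁ ≈ᴵ P ^ᴵ e · Q → _
      fromʳ (Y₁ , XY₁≈) with divide-prime-power e Q X Y₁ P-prime dQ XY₁≈
      ... | f , X′ , Y′ , f≤e , X≈ , X′Y′≈Q = f , X′ , Y′ , m≤n⇒m≤1+n f≤e , X≈ , X′Y′≈Q

    private
      ∏^ : ∀ {g} → Vector Ideal g → Vector ℕ g → Ideal
      ∏^ 𝔭 e = ∏ (λ i → 𝔭 i ^ᴵ e i)

    factor-of-∏ : ∀ {g} (𝔭 : Vector Ideal g) (e : Vector ℕ g) X Y → (∀ i → IsPrime (𝔭 i)) →
                  Divisor (∏^ 𝔭 e) → X · Y ≈ᴵ ∏^ 𝔭 e →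
                  Σ[ f ∈ Vector ℕ g ] (∀ i → f i ≤ e i) × X ≈ᴵ ∏^ 𝔭 f
    factor-of-∏ {zero} 𝔭 e X Y primes d XY≈1 =
      -- With no primes left X · Y is ⟨1⟩, and a product lies in each of its factors, so X is ⟨1⟩
      -- too.
      (λ ()) , (λ ()) , ⊆-⟨1⟩ X , ·-⊆ˡ X Y ∘ proj₂ XY≈1
    factor-of-∏ {suc g} 𝔭 e X Y primes d XY≈
      with divide-prime-power (e zero) (∏^ (𝔭 ∘ suc) (e ∘ suc)) X Y (primes zero) d XY≈
    ... | f₀ , X′ , Y′ , f₀≤e₀ , X≈ , X′Y′≈
      with factor-of-∏ (𝔭 ∘ suc) (e ∘ suc) X′ Y′ (primes ∘ suc)
             (divisorʳ (𝔭 zero ^ᴵ e zero) (∏^ (𝔭 ∘ suc) (e ∘ suc)) d) X′Y′≈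
    ... | f , f≤e , X′≈ = f′ , f′≤e , (begin
      X                                ≈⟨ X≈ ⟩
      𝔭 zero ^ᴵ f₀ · X′                ≈⟨ ·.∙-congˡ X′≈ ⟩
      𝔭 zero ^ᴵ f₀ · ∏^ (𝔭 ∘ suc) f    ∎)
      where
      open SetoidReasoning ·.setoid

      f′ : Vector ℕ (suc g)
      f′ zero    = f₀
      f′ (suc i) = f i

      f′≤e : ∀ i → f′ i ≤ e i
      f′≤e zero    = f₀≤e₀
      f′≤e (suc i) = f≤e i

    factor-isIdealDivisor : PrimeFactorization ⟨α⟩ → ∀ x y → α ≈ x * y →
                            IsIdealDivisor ⟨ x ⟩ ⟨α⟩
    factor-isIdealDivisor F x y α≈xy =
      F , factor-of-∏ 𝔭 e ⟨ x ⟩ ⟨ y ⟩ primes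
        (⟨ 1# ⟩ , ·.trans {D · ⟨ 1# ⟩} {D} {⟨α⟩} (·.identityʳ D) (·.sym {⟨α⟩} {D} factors))
        (·.trans {⟨ x ⟩ · ⟨ y ⟩} {⟨α⟩} {D} (⟨⟩-· α≈xy) factors)
      where
      open PrimeFactorization F
      D = ∏^ 𝔭 e

    -- Irreducibility from the count of principal ideal divisors.

    n≡2⇒irreducible : n⟨ α ⟩≡ 2 → Irreducible (RawRing.rawSemiring rawRing) α
    n≡2⇒irreducible n≡2 = record
      -- Divisibility and membership in a principal ideal hold the same data in different records,
      -- hence the repackaging.
      { p∤1      = λ { (q , e) → α∤1 (q , e) }
      ; split-∣1 = Sum.map (λ { (q , e) → q , e }) (λ { (q , e) → q , e }) ∘ split
      }
      where
      open Inverse n≡2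
      open Setoid (principalIdealDivisors α) using () renaming (Carrier to PrincipalDivisor)

      -- The count itself supplies a factorization: every counted divisor carries one, and `to zero`
      -- is such a divisor.
      F : PrimeFactorization ⟨α⟩
      F = proj₁ (proj₁ (proj₂ (to zero)))

      principal : ∀ x y → α ≈ x * y → PrincipalDivisor
      principal x y α≈xy = ⟨ x ⟩ , factor-isIdealDivisor F x y α≈xy , x , ·.refl {⟨ x ⟩}

      from-injective : ∀ I J → from I ≡ from J → proj₁ I ≈ᴵ proj₁ J
      from-injective I J eq = ·.trans {proj₁ I} {proj₁ (to (from J))} {proj₁ J}
        (·.sym {proj₁ (to (from J))} {proj₁ I} (inverseˡ (≡.sym eq))) (inverseˡ ≡.refl)

      -- Otherwise every divisor, containing `⟨α⟩`, would be the whole ring, and the two indices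
      -- would coincide.
      α∤1 : ¬ 1# ∈ᴵ ⟨ α ⟩
      α∤1 α∣1 with ≡.trans (≡.sym (strictlyInverseʳ zero))
                     (≡.trans (from-cong ((λ _ → ⊤⊆ (suc zero)) , (λ _ → ⊤⊆ zero)))
                       (strictlyInverseʳ (suc zero)))
        where
        ⊤⊆ : ∀ k {x} → x ∈ᴵ proj₁ (to k)
        ⊤⊆ k = ideal-divisor-⊇ ⟨α⟩ (proj₁ (to k)) (proj₁ (proj₂ (to k)))
          (⟨⟩-least ⟨α⟩ α∣1 (_ , *-identityʳ _))
      ... | ()

      split : ∀ {x y} → α ≈ x * y → (∃[ q ] q * x ≈ 1#) ⊎ (∃[ q ] q * y ≈ 1#)
      split {x} {y} α≈xy = Sum.map
        (λ from-x≡from-1 → proj₂ (from-injective Dx D1 from-x≡from-1) (x∈⟨x⟩ 1#))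
        (λ from-x≡from-α → y∣1 (proj₁ (from-injective Dx Dα from-x≡from-α) (x∈⟨x⟩ x)))
        -- ⟨1⟩ and `⟨α⟩` have different indices, so the index of ⟨x⟩ is one of theirs.
        (Fin2-exhausted
          (λ from-1≡from-α → α∤1 (proj₁ (from-injective D1 Dα from-1≡from-α) (x∈⟨x⟩ 1#)))
          (from Dx))
        where
        D1 = principal 1# α (sym (*-identityˡ α))
        Dα = principal α 1# (sym (*-identityʳ α))
        Dx = principal x y α≈xy

        -- Substituting x = r * α into α = x * y gives r * y * α = α, and `α` cancels.
        y∣1 : x ∈ᴵ ⟨ α ⟩ → ∃[ q ] q * y ≈ 1#
        y∣1 (r , rα≈x) = r , α-cancel (r * y) 1# (begin
          r * y * α     ≈⟨ *-assoc r y α ⟩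
          r * (y * α)   ≈⟨ x∙yz≈y∙xz r y α ⟩
          y * (r * α)   ≈⟨ *-congˡ rα≈x ⟩
          y * x         ≈⟨ *-comm y x ⟩
          x * y         ≈⟨ α≈xy ⟨
          α             ≈⟨ *-identityˡ α ⟨
          1# * α        ∎)
          where open SetoidReasoning setoid

-- Cancellation in a number field.

module _ {c ℓ₁ ℓ₂} (K : NumberField c ℓ₁ ℓ₂) where

  open NumberField K
  open SetoidReasoning setoid

  ≉0⇒cancelʳ : ∀ {a} → ¬ (a ≈ 0#) → ∀ x y → x * a ≈ y * a → x ≈ y
  ≉0⇒cancelʳ {a} a≉0 x y xa≈ya = begin
    x             ≈⟨ x≈xaa⁻¹ x ⟩
    x * a * a⁻¹   ≈⟨ *-congʳ xa≈ya ⟩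
    y * a * a⁻¹   ≈⟨ x≈xaa⁻¹ y ⟨
    y             ∎
    where
    -- Apartness from zero yields an inverse of the difference `a - 0#`, which `a-0≈a` then
    -- identifies with `a`.
    a-0-invertible = #⇒invertible (≉⇒# a≉0)
    a⁻¹ = proj₁ a-0-invertible

    a-0≈a : a - 0# ≈ a
    a-0≈a = trans (+-congˡ (RingProperties.-0#≈0# (CommutativeRing.ring commutativeRing)))
                  (+-identityʳ a)

    x≈xaa⁻¹ : ∀ x → x ≈ x * a * a⁻¹
    x≈xaa⁻¹ x = begin
      x                      ≈⟨ *-identityʳ x ⟨
      x * 1#                 ≈⟨ *-congˡ (proj₂ (proj₂ a-0-invertible)) ⟨
      x * ((a - 0#) * a⁻¹)   ≈⟨ *-congˡ (*-congʳ a-0≈a) ⟩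
      x * (a * a⁻¹)          ≈⟨ *-assoc x a a⁻¹ ⟨
      x * a * a⁻¹            ∎

lemma2 : ∀ {c ℓ₁ ℓ₂ : Level} (K : NumberField c ℓ₁ ℓ₂) →
    let open CommutativeRing (𝓞 K)
        open Ideals (𝓞 K)
    in (α : Carrier) → ¬ (α ≈ 0#) → n⟨ α ⟩≡ 2 →
       Irreducible (RawRing.rawSemiring rawRing) α
lemma2 K α α≉0 = IdealProperties.Divisors.n≡2⇒irreducible (𝓞 K) α
  -- Equality and multiplication in `𝓞 K` are those of `K` on first components, so cancellation
  -- carries over.
  (λ x y → ≉0⇒cancelʳ K α≉0 (proj₁ x) (proj₁ y))
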